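{- Assume Markov induction and computable choice. Let $\chi:\mathbb{N}\to\nabla_0\mathbb{N}$ be an oracle. Then for every $z:\bigcirc_\chi\mathbb{N}$ there merely exists $e:\mathbb{N}$ such that $\psi^\chi(e)\downarrow=z$.
   Context: Setting: homotopy type theory with a univalent universe $\mathcal{U}$ of small types and higher inductive types. It is assumed that there is a small type $\Omega_{\neg\neg}:\mathcal{U}$ classifying $\neg\neg$-stable propositions. For a type $X$, $\nabla_0X$ is the type of $\xi:X\to\Omega_{\neg\neg}$ such that $\neg\neg\sum_{x:X}\xi(x)$ and $\prod_{x,y:X}\xi(x)\to\xi(y)\to\neg\neg(x=y)$; write $\xi\downarrow:=\sum_{x:X}\xi(x)$ and $\xi\downarrow=x$ for $\xi(x)$. The nullification at a family $B:A\to\mathcal{U}$ is the higher modality whose modal types are the $X$ with every constant map $X\to X^{B(a)}$ an equivalence. An oracle is a map $\chi:A\to\nabla_0B$; $\bigcirc_\chi$ is the nullification at $a\mapsto\chi(a)\downarrow$, with unit $\eta$; for every $n$ we have an element of $\bigcirc_\chi(\chi(n)\downarrow)$. Computability: a function $\varphi:\mathbb{N}\times\mathbb{N}\times\mathbb{N}\to\mathbb{N}+\{\bot\}$, written $\varphi_e^k(n)$, is postulated such that for all $e,n$ at most one $k$ has $\varphi_e^k(n)\in\mathbb{N}$; $\varphi_e(n)\downarrow=m$ means $\sum_k\varphi_e^k(n)=m$ and $\varphi_e(n)\downarrow$ means $\sum_m\varphi_e(n)\downarrow=m$. Computable choice (CC): for every $R:\mathbb{N}\times\mathbb{N}\to\Omega_{\neg\neg}$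 with $\prod_n\left(\neg\neg\sum_m R\,n\,m\to\|\sum_m R\,n\,m\|\right)$ there merely exists $e$ such that for all $n$, if $\neg\neg\sum_m R\,n\,m$ then $\varphi_e(n)\downarrow$ and $R\,n\,\varphi_e(n)$. Markov induction (MI): with $\mathtt{IsSuc}(\mu,\nu):=\prod_{m}(\mu\downarrow=m)\to(\nu\downarrow=m+1)$ on $\nabla_0\mathbb{N}$, for every $P:\nabla_0\mathbb{N}\to\mathcal{U}$ and $h:\prod_\nu(\prod_\mu\mathtt{IsSuc}(\mu,\nu)\to P(\mu))\to P(\nu)$ there is a section $\prod_\nu P(\nu)$. The coding $\psi^\chi$: fix a bijection $\theta:\mathbb{N}\cong\mathbb{N}+(\mathbb{N}\times\mathbb{N})$. For lists $\vec k=[k_1,\dots,k_m]$ of naturals and $x:\mathbb{N}+\mathbb{N}\times\mathbb{N}$ define $\psi^\chi_{\vec k}(x):\bigcirc_\chi(\mathbb{N}+\{\bot\})$ by recursion on $m$: $\psi^\chi_{[]}(\mathrm{inl}(n))=\eta(n)$, $\psi^\chi_{[]}(\mathrm{inr}(\_))=\eta(\bot)$; for $m>0$, $\psi^\chi_{[k_1,\dots,k_m]}(\mathrm{inl}(n))=\eta(\bot)$, and $\psi^\chi_{[k_1,\dots,k_m]}(\mathrm{inr}(n,e))$ is defined inside $\bigcirc_\chi$ from the element of $\bigcirc_\chi(\chi(n)\downarrow)$: given $b$ with $\chi(n)\downarrow=b$, it is $\psi^\chi_{[k_1,\dots,k_{m-1}]}(\theta(c))$ if $\varphi_e^{k_m}(b)=c\in\mathbb{N}$,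 and $\eta(\bot)$ if $\varphi_e^{k_m}(b)=\bot$. For $e:\mathbb{N}$, $\psi^\chi(e)$ is the partial element of $\bigcirc_\chi\mathbb{N}$ with domain $\psi^\chi(e)\downarrow:=\bigcirc_\chi\sum_{\vec k}\sum_{n:\mathbb{N}}\psi^\chi_{\vec k}(\theta(e))=\eta(n)$ and value obtained by applying $\bigcirc_\chi$ to the projection to $n$; $\psi^\chi(e)\downarrow=z$ means the domain holds with value $z$. -}

{-# OPTIONS --without-K #-}
-- K is off because the theory assumes univalence, which refutes it.
module Defs where

open import Level using (Level; Setω; _⊔_)
open import Axiom.Extensionality.Propositional using (Extensionality)
open import Data.List.Base using (List; []; _∷_)
open import Data.Maybe.Base using (Maybe; just; nothing)
open import Data.Nat.Base using (ℕ; suc)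
open import Data.Product.Base using (Σ-syntax; ∃-syntax; _×_; _,_; proj₁; proj₂)
open import Data.Sum.Base using (_⊎_; inj₁; inj₂)
open import Function.Base using (id; const; _∘_)
open import Function.Bundles using (_⇔_; _↔_; Equivalence; Inverse)
open import Relation.Binary.PropositionalEquality.Core using (_≡_; refl; cong)
open import Relation.Nullary.Negation.Core using (¬_)
open import Relation.Nullary using (Irrelevant; Stable)

private
  variable
    a b : Level

-- The universe 𝒰 of small types is Set; univalence and the
-- higher inductive types are hypotheses, as they are not available here.
-- Irrelevant is the library's name for being a mere proposition.

-- Bi-invertible maps; unlike having a two-sided inverse, this is a proposition.
isEquiv : {X : Set a} {Y : Set b} → (X → Y) → Set (a ⊔ b)
isEquiv {X = X} {Y = Y} f =
  (Σ[ g ∈ (Y → X) ] (∀ x → g (f x) ≡ x)) × (Σ[ h ∈ (Y → X) ] (∀ y → f (h y) ≡ y))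

infix 4 _≃_

_≃_ : Set a → Set b → Set (a ⊔ b)
X ≃ Y = Σ[ f ∈ (X → Y) ] isEquiv f

idToEquiv : {X Y : Set a} → X ≡ Y → X ≃ Y
idToEquiv refl = id , (id , λ _ → refl) , (id , λ _ → refl)

Univalence : Set₁
Univalence = {X Y : Set} → isEquiv (idToEquiv {X = X} {Y = Y})

FunExt : Setω
FunExt = ∀ {a b} → Extensionality a b

record PropositionalTruncation : Setω where
  field
    ∥_∥     : Set a → Set a
    ∣_∣     : {X : Set a} → X → ∥ X ∥
    ∥∥-prop : {X : Set a} → Irrelevant ∥ X ∥
    ∥∥-rec  : {X : Set a} {P : Set b} → Irrelevant P → (X → P) → ∥ X ∥ → P

-- Higher modalities in the sense of Rijke, Shulman and Spitters.
record HigherModality : Set₁ where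
  field
    ◯       : Set → Set
    η       : {X : Set} → X → ◯ X
    ◯-ind   : {X : Set} (P : ◯ X → Set) →
              ((x : X) → ◯ (P (η x))) → (z : ◯ X) → ◯ (P z)
    ◯-ind-η : {X : Set} (P : ◯ X → Set) (f : (x : X) → ◯ (P (η x))) (x : X) →
              ◯-ind P f (η x) ≡ f x
    η-≡     : {X : Set} (x y : ◯ X) → isEquiv (η {X = x ≡ y})

  isModal : Set → Set
  isModal X = isEquiv (η {X = X})

  ◯-bind : {X Y : Set} → ◯ X → (X → ◯ Y) → ◯ Y
  ◯-bind {Y = Y} z f = ◯-ind (const Y) f z

  ◯-map : {X Y : Set} → (X → Y) → ◯ X → ◯ Y
  ◯-map f z = ◯-bind z (η ∘ f)

  ◯-isModal : (X : Set) → isModal (◯ X)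
  ◯-isModal X = (join , join-η) , (join , η-join)
    where
    join : ◯ (◯ X) → ◯ X
    join = ◯-ind (const X) id

    join-η : (x : ◯ X) → join (η x) ≡ x
    join-η = ◯-ind-η (const X) id

    η-join : (z : ◯ (◯ X)) → η (join z) ≡ z
    η-join z = proj₁ (proj₁ (η-≡ _ _))
      (◯-ind (λ z → η (join z) ≡ z) (λ x → η (cong η (join-η x))) z)

isNull : {A : Set} (B : A → Set) → Set → Set
isNull B X = ∀ a → isEquiv {X = X} {Y = B a → X} const

record Nullification {A : Set} (B : A → Set) : Set₁ where
  field
    modality     : HigherModality

  open HigherModality modality public

  field
    modal⇔isNull : (X : Set) → isModal X ⇔ isNull B X

  -- ◯ X is null, so η {B a} : B a → ◯ (B a) is constant at a unique point.
  point : (a : A) → ◯ (B a)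
  point a = proj₁ (proj₂ (Equivalence.to (modal⇔isNull (◯ (B a))) (◯-isModal (B a)) a)) η

StableProp : Set₁
StableProp = Σ[ P ∈ Set ] (Irrelevant P × Stable P)

record ¬¬-Classifier : Set₁ where
  field
    Ω              : Set
    decode         : Ω → StableProp
    decode-isEquiv : isEquiv decode

  El : Ω → Set
  El p = proj₁ (decode p)

  ∇₀ : Set → Set
  ∇₀ X = Σ[ ξ ∈ (X → Ω) ]
    (¬ ¬ (∃[ x ] El (ξ x))) × (∀ x y → El (ξ x) → El (ξ y) → ¬ ¬ (x ≡ y))

  infix 4 _↓=_

  _↓=_ : {X : Set} → ∇₀ X → X → Set
  ξ ↓= x = El (proj₁ ξ x)

  _↓ : {X : Set} → ∇₀ X → Set
  ξ ↓ = ∃[ x ] ξ ↓= x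

  Oracle : Set → Set → Set
  Oracle A B = A → ∇₀ B

  IsSuc : ∇₀ ℕ → ∇₀ ℕ → Set
  IsSuc μ ν = ∀ m → μ ↓= m → ν ↓= suc m

  MarkovInduction : Set₁
  MarkovInduction = (P : ∇₀ ℕ → Set) →
    (∀ ν → (∀ μ → IsSuc μ ν → P μ) → P ν) → ∀ ν → P ν

-- φ e k n is φ_e^k(n), with nothing for ⊥.
record Computation : Set where
  field
    φ            : ℕ → ℕ → ℕ → Maybe ℕ
    φ-functional : ∀ e n k k′ m m′ → φ e k n ≡ just m → φ e k′ n ≡ just m′ → k ≡ k′

  φ⟨_⟩_↓=_ : ℕ → ℕ → ℕ → Set
  φ⟨ e ⟩ n ↓= m = ∃[ k ] φ e k n ≡ just m

  φ⟨_⟩_↓ : ℕ → ℕ → Set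
  φ⟨ e ⟩ n ↓ = ∃[ m ] φ⟨ e ⟩ n ↓= m

ComputableChoice : PropositionalTruncation → ¬¬-Classifier → Computation → Set
ComputableChoice T C K = (R : ℕ → ℕ → Ω) →
  (∀ n → ¬ ¬ (∃[ m ] El (R n m)) → ∥ (∃[ m ] El (R n m)) ∥) →
  ∥ (∃[ e ] (∀ n → ¬ ¬ (∃[ m ] El (R n m)) →
      Σ[ d ∈ φ⟨ e ⟩ n ↓ ] El (R n (proj₁ d)))) ∥
  where
  open PropositionalTruncation T
  open ¬¬-Classifier C
  open Computation K

module Coding
  (C : ¬¬-Classifier) (K : Computation) (θ : ℕ ↔ (ℕ ⊎ (ℕ × ℕ)))
  (χ : ¬¬-Classifier.Oracle C ℕ ℕ) (N : Nullification (λ n → ¬¬-Classifier._↓ C (χ n)))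
  where
  open Computation K
  open Nullification N

  -- The recursion removes the last entry of [k₁,…,kₘ], so that list is stored as
  -- kₘ ∷ … ∷ k₁ ∷ [].
  mutual
    ψ-list : List ℕ → ℕ ⊎ (ℕ × ℕ) → ◯ (Maybe ℕ)
    ψ-list []       (inj₁ n)       = η (just n)
    ψ-list []       (inj₂ _)       = η nothing
    ψ-list (k ∷ ks) (inj₁ n)       = η nothing
    ψ-list (k ∷ ks) (inj₂ (n , e)) = ◯-bind (point n) (λ (b , _) → ψ-next ks (φ e k b))

    ψ-next : List ℕ → Maybe ℕ → ◯ (Maybe ℕ)
    ψ-next ks (just c) = ψ-list ks (Inverse.to θ c)
    ψ-next ks nothing  = η nothing

  ψ_↓ : ℕ → Set
  ψ e ↓ = ◯ (Σ[ ks ∈ List ℕ ] Σ[ n ∈ ℕ ] ψ-list ks (Inverse.to θ e) ≡ η (just n))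

  ψ-value : (e : ℕ) → ψ e ↓ → ◯ ℕ
  ψ-value e = ◯-map (λ (_ , n , _) → n)

  ψ_↓=_ : ℕ → ◯ ℕ → Set
  ψ e ↓= z = Σ[ d ∈ ψ e ↓ ] ψ-value e d ≡ z

{-# OPTIONS --safe #-}
{-# OPTIONS --without-K #-}
-- The statement ψ(e)↓ = z turns out to be ¬¬-stable. Indeed the list k⃗ witnessing
-- ψ(e)↓ is unique up to length, so its length is an element of ∇₀ ℕ, and Markov
-- induction on it turns ¬¬ ψ(e)↓ into ψ(e)↓; moreover ◯ ℕ has ¬¬-stable equality,
-- because the types χ(n)↓ are ¬¬-dense propositions. Hence, if every b with
-- χ(n)↓ = b merely has a code c_b of z, computable choice yields an index e for
-- b ↦ c_b, and (n , e) codes z. So "z merely has a code" is a null proposition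
-- of z, and it suffices to code each η m.
module Submission where

open import Data.Empty using (⊥; ⊥-elim)
open import Data.List.Base using (List; []; _∷_; length)
open import Data.Maybe.Base using (Maybe; just; nothing)
open import Data.Maybe.Properties using (just-injective)
open import Data.Nat.Base using (ℕ; zero; suc; _+_)
open import Data.Nat.Properties using (_≟_; +-suc; +-identityʳ)
open import Data.Product.Base using (Σ-syntax; _×_; ∃-syntax; _,_; proj₁; proj₂)
open import Data.Sum.Base using (_⊎_; inj₁; inj₂)
open import Function.Base using (id; _∘_)
open import Function.Bundles using (_↔_; Equivalence; Inverse)
open import Relation.Binary.PropositionalEquality
  using (_≡_; _≢_; refl; sym; trans; cong; cong₂; cong-app; subst)
open import Relation.Nullary using (Irrelevant; Stable)
open import Relation.Nullary.Decidable using (decidable-stable)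
open import Relation.Nullary.Negation using (¬_; contradiction; negated-stable)
open import Axiom.UniquenessOfIdentityProofs using (UIP; module Constant⇒UIP)
open import Defs
open PropositionalTruncation using (∥_∥)
open ¬¬-Classifier using (Oracle; _↓; MarkovInduction)

Irrelevant⇒UIP : {P : Set} → Irrelevant P → UIP P
Irrelevant⇒UIP irr = Constant⇒UIP.≡-irrelevant (λ _ → irr _ _) (λ _ _ → refl)

module StablePropositions (ext : FunExt) (ua : Univalence) (C : ¬¬-Classifier) where
  open ¬¬-Classifier C hiding (Oracle; _↓; MarkovInduction)

  IsStableProp : Set → Set
  IsStableProp P = Irrelevant P × Stable P

  IsStableProp-irrelevant : {P : Set} → Irrelevant (IsStableProp P)
  IsStableProp-irrelevant (i , s) (i′ , s′) = cong₂ _,_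
    (ext λ p → ext λ q → Irrelevant⇒UIP i (i p q) (i′ p q))
    (ext λ nn → i (s nn) (s′ nn))

  StableProp-ext : (P Q : StableProp) →
                   (proj₁ P → proj₁ Q) → (proj₁ Q → proj₁ P) → P ≡ Q
  StableProp-ext (P , P-sp) (Q , Q-sp) f g =
    lift (proj₁ (proj₁ ua)
      (f , (g , λ x → proj₁ P-sp _ _) , (g , λ y → proj₁ Q-sp _ _)))
    where
    lift : P ≡ Q → _≡_ {A = StableProp} (P , P-sp) (Q , Q-sp)
    lift refl = cong (P ,_) (IsStableProp-irrelevant P-sp Q-sp)

  Ω-ext : (p q : Ω) → (El p → El q) → (El q → El p) → p ≡ q
  Ω-ext p q f g =
    trans (sym (proj₂ (proj₁ decode-isEquiv) p))
      (trans (cong (proj₁ (proj₁ decode-isEquiv))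
               (StableProp-ext (decode p) (decode q) f g))
        (proj₂ (proj₁ decode-isEquiv) q))

  El-irrelevant : (p : Ω) → Irrelevant (El p)
  El-irrelevant p = proj₁ (proj₂ (decode p))

  El-stable : (p : Ω) → Stable (El p)
  El-stable p = proj₂ (proj₂ (decode p))

  ¬¬-StableProp : Set → StableProp
  ¬¬-StableProp P = (¬ ¬ P) , (λ f g → ext λ k → ⊥-elim (f k)) , negated-stable

  ⌜_⌝ : Set → Ω
  ⌜ P ⌝ = proj₁ (proj₂ decode-isEquiv) (¬¬-StableProp P)

  El-⌜⌝ : (P : Set) → El ⌜ P ⌝ ≡ (¬ ¬ P)
  El-⌜⌝ P = cong proj₁ (proj₂ (proj₂ decode-isEquiv) (¬¬-StableProp P))

  ⌜⌝-intro : {P : Set} → ¬ ¬ P → El ⌜ P ⌝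
  ⌜⌝-intro {P} = subst id (sym (El-⌜⌝ P))

  ⌜⌝-elim : {P : Set} → El ⌜ P ⌝ → ¬ ¬ P
  ⌜⌝-elim {P} = subst id (El-⌜⌝ P)

  ↓-irrelevant : (ξ : ∇₀ ℕ) → Irrelevant (∃[ n ] ξ ↓= n)
  ↓-irrelevant (ξ , _ , unique) (x , p) (y , q) =
    aux (decidable-stable (x ≟ y) (unique x y p q))
    where
    aux : x ≡ y → (x , p) ≡ (y , q)
    aux refl = cong (x ,_) (El-irrelevant (ξ x) p q)

  pred : (ν : ∇₀ ℕ) → ¬ (ν ↓= 0) → ∇₀ ℕ
  pred (ξ , inhabited , unique) ν≢0 =
    ξ ∘ suc ,
    (λ k → inhabited λ { (zero , p) → ν≢0 p ; (suc m , p) → k (m , p) }) ,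
    (λ x y p q k → unique (suc x) (suc y) p q λ { refl → k refl })

  -- MarkovInduction supplies P μ at every predecessor μ of ν; pred ν is the only
  -- one that gets used, once the case ν = 0 is settled.
  Markov-pred : MarkovInduction C → (P : ∇₀ ℕ → Set) →
                (∀ ν → ((ν≢0 : ¬ (ν ↓= 0)) → P (pred ν ν≢0)) → P ν) → ∀ ν → P ν
  Markov-pred mi P step =
    mi P λ ν h → step ν λ ν≢0 → h (pred ν ν≢0) λ _ → id

  Markov's-principle : MarkovInduction C → {A : Set} (f : ℕ → Maybe A) →
    (∀ k k′ a a′ → f k ≡ just a → f k′ ≡ just a′ → k ≡ k′) →
    ¬ ¬ (∃[ k ] ∃[ a ] f k ≡ just a) → ∃[ k ] ∃[ a ] f k ≡ just a
  Markov's-principle mi {A} f f-unique nn = Markov-pred mi P step ν 0 λ _ → ⌜⌝-elim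
    where
    Halts : ℕ → Set
    Halts k = ∃[ a ] f k ≡ just a

    P : ∇₀ ℕ → Set
    P ν = ∀ s → (∀ m → ν ↓= m → ¬ ¬ Halts (s + m)) → ∃[ k ] Halts k

    step : ∀ ν → ((ν≢0 : ¬ (ν ↓= 0)) → P (pred ν ν≢0)) → P ν
    step ν ih s h with f s in eq
    ... | just a  = s , a , eq
    ... | nothing = ih ν≢0 (suc s) λ m p →
      subst (λ k → ¬ ¬ Halts k) (+-suc s m) (h (suc m) p)
      where
      ν≢0 : ¬ (ν ↓= 0)
      ν≢0 p = h 0 p λ (a , q) →
        contradiction (trans (sym eq) (trans (cong f (sym (+-identityʳ s))) q)) λ ()

    ν : ∇₀ ℕ
    ν = (λ k → ⌜ Halts k ⌝) ,
        (λ k → nn λ (x , p) → k (x , ⌜⌝-intro λ j → j p)) ,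
        λ x y p q k → ⌜⌝-elim p λ (a , fx) → ⌜⌝-elim q λ (a′ , fy) →
          k (f-unique x y a a′ fx fy)

module NullificationProperties {A : Set} {B : A → Set} (N : Nullification B) where
  open Nullification N public

  isNull⇒isModal : {X : Set} → isNull B X → isModal X
  isNull⇒isModal = Equivalence.from (modal⇔isNull _)

  ◯-elim-modal : {X Y : Set} → isModal Y → ◯ X → (X → Y) → Y
  ◯-elim-modal Y-modal z f = proj₁ (proj₁ Y-modal) (◯-map f z)

  ◯-bind-η : {X Y : Set} (x : X) (f : X → ◯ Y) → ◯-bind (η x) f ≡ f x
  ◯-bind-η x f = ◯-ind-η _ f x

  point-≡ : ∀ {a} (b : B a) → point a ≡ η b
  point-≡ {a} = cong-app
    (proj₂ (proj₂ (Equivalence.to (modal⇔isNull _) (◯-isModal (B a)) a)) η)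

  ◯-bind-point : ∀ {a} {Y : Set} (b : B a) (f : B a → ◯ Y) → ◯-bind (point a) f ≡ f b
  ◯-bind-point b f = trans (cong (λ z → ◯-bind z f) (point-≡ b)) (◯-bind-η b f)

  module Dense (ext : FunExt) (B-dense : ∀ a → ¬ ¬ B a) where

    isNull-irrelevant : {X : Set} → Irrelevant X → (∀ a → (B a → X) → X) → isNull B X
    isNull-irrelevant irr g a =
      (g a , λ x → irr _ _) , (g a , λ f → ext λ b → irr _ _)

    ⊥-isModal : isModal ⊥
    ⊥-isModal = isNull⇒isModal (isNull-irrelevant (λ ()) λ a f → ⊥-elim (B-dense a f))

    ◯⇒¬¬ : {X : Set} → ◯ X → ¬ ¬ X
    ◯⇒¬¬ z k = ◯-elim-modal ⊥-isModal z k

    η-dense : {X : Set} (z : ◯ X) → ¬ ¬ (∃[ x ] z ≡ η x)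
    η-dense z = ◯⇒¬¬ (◯-ind (λ z → ∃[ x ] z ≡ η x) (λ x → η (x , refl)) z)

  module DensePropositions
    (ext : FunExt) (ua : Univalence) (C : ¬¬-Classifier)
    (B-irrelevant : ∀ a → Irrelevant (B a)) (B-dense : ∀ a → ¬ ¬ B a) where
    open StablePropositions ext ua C
    open ¬¬-Classifier C using (Ω; El)
    open Dense ext B-dense public

    Ω-isModal : isModal Ω
    Ω-isModal = isNull⇒isModal λ a →
      (glue a , λ p → Ω-ext _ _
        (λ q → El-stable p λ k → ⌜⌝-elim q λ h → B-dense a (k ∘ h))
        (λ q → ⌜⌝-intro λ k → k λ _ → q)) ,
      (glue a , λ f → ext λ b → Ω-ext _ _
        (λ q → El-stable (f b) λ k → ⌜⌝-elim q λ h → k (h b))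
        (λ q → ⌜⌝-intro λ k → k λ b′ → subst (El ∘ f) (B-irrelevant a b b′) q))
      where
      glue : ∀ a → (B a → Ω) → Ω
      glue a f = ⌜ (∀ b → El (f b)) ⌝

    η-¬¬-injective : {X : Set} (x y : X) → η x ≡ η y → ¬ ¬ (x ≡ y)
    η-¬¬-injective {X} x y eq = ⌜⌝-elim
      (subst El (trans (sym (code-η x)) (trans (cong code eq) (code-η y)))
        (⌜⌝-intro λ k → k refl))
      where
      code : ◯ X → Ω
      code z = ◯-elim-modal Ω-isModal z λ y → ⌜ x ≡ y ⌝

      code-η : ∀ y → code (η y) ≡ ⌜ x ≡ y ⌝
      code-η y = trans (cong (proj₁ (proj₁ Ω-isModal)) (◯-bind-η y _))
                       (proj₂ (proj₁ Ω-isModal) _)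

    ◯-≡-stable : {X : Set} → ((x y : X) → Stable (x ≡ y)) →
                 (z w : ◯ X) → Stable (z ≡ w)
    ◯-≡-stable {X} X-stable z w =
      ◯-elim-modal′ (◯-ind (λ z → ∀ w → Stable (z ≡ w)) (λ x → η (η-stable x)) z) w
      where
      ◯-elim-modal′ : {z : ◯ X} → ◯ (∀ w → Stable (z ≡ w)) → ∀ w → Stable (z ≡ w)
      ◯-elim-modal′ u w nn = ◯-elim-modal (η-≡ _ _) u λ h → h w nn

      η-stable : (x : X) (w : ◯ X) → Stable (η x ≡ w)
      η-stable x w nn = ◯-elim-modal (η-≡ _ _)
        (◯-ind (λ w → Stable (η x ≡ w))
          (λ y → η λ nn → cong η (X-stable x y λ k → nn λ p → η-¬¬-injective x y p k)) w)
        λ h → h nn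

module CodingProperties
  (ext : FunExt) (ua : Univalence) (C : ¬¬-Classifier) (K : Computation)
  (θ : ℕ ↔ (ℕ ⊎ (ℕ × ℕ))) (χ : Oracle C ℕ ℕ) (N : Nullification (λ n → _↓ C (χ n)))
  where
  open ¬¬-Classifier C using (∇₀; _↓=_)
  open StablePropositions ext ua C
  open Computation K
  open NullificationProperties N
  open DensePropositions ext ua C
    (↓-irrelevant ∘ χ) (λ n → proj₁ (proj₂ (χ n)))
  open Coding C K θ χ N

  ⟦_⟧ : ℕ → ℕ ⊎ (ℕ × ℕ)
  ⟦_⟧ = Inverse.to θ

  Converges : List ℕ → ℕ ⊎ (ℕ × ℕ) → ℕ → Set
  Converges ks x n = ψ-list ks x ≡ η (just n)

  Defined : ℕ ⊎ (ℕ × ℕ) → Set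
  Defined x = Σ[ ks ∈ List ℕ ] Σ[ n ∈ ℕ ] Converges ks x n

  η-nothing≢η-just : ∀ {n : ℕ} → η nothing ≢ η (just n)
  η-nothing≢η-just eq = η-¬¬-injective _ _ eq λ ()

  Converges-inj₁ : ∀ {n m} → Converges [] (inj₁ n) m → n ≡ m
  Converges-inj₁ {n} {m} eq = decidable-stable (n ≟ m) λ k →
    η-¬¬-injective _ _ eq (k ∘ just-injective)

  Converges-∷ : ∀ {n e k ks b c m} → χ n ↓= b → φ e k b ≡ just c →
                Converges ks ⟦ c ⟧ m → Converges (k ∷ ks) (inj₂ (n , e)) m
  Converges-∷ {ks = ks} β eq p =
    trans (◯-bind-point (_ , β) _) (trans (cong (ψ-next ks) eq) p)

  Converges-∷⁻ : ∀ {n e k ks b m} → χ n ↓= b → Converges (k ∷ ks) (inj₂ (n , e)) m →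
                 ∃[ c ] φ e k b ≡ just c × Converges ks ⟦ c ⟧ m
  Converges-∷⁻ {n} {e} {k} {ks} {b} {m} β p =
    split (φ e k b) refl (trans (sym (◯-bind-point (b , β) _)) p)
    where
    split : ∀ r → φ e k b ≡ r → ψ-next ks r ≡ η (just m) →
            ∃[ c ] φ e k b ≡ just c × Converges ks ⟦ c ⟧ m
    split (just c) eq q = c , eq , q
    split nothing  eq q = ⊥-elim (η-nothing≢η-just q)

  φ-deterministic : ∀ {e n k k′ m m′} → φ e k n ≡ just m → φ e k′ n ≡ just m′ →
                    m ≡ m′
  φ-deterministic {e} {n} {k} {k′} {m} {m′} p p′ = just-injective
    (trans (sym p) (trans (cong (λ i → φ e i n) (φ-functional e n k k′ m m′ p p′)) p′))

  Converges-unique : ∀ ks ks′ x {n n′} → Converges ks x n → Converges ks′ x n′ →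
                     ¬ ¬ (length ks ≡ length ks′ × n ≡ n′)
  Converges-unique [] [] (inj₁ _) p q k =
    k (refl , trans (sym (Converges-inj₁ p)) (Converges-inj₁ q))
  Converges-unique (_ ∷ _) ks′ (inj₁ _) p q = ⊥-elim (η-nothing≢η-just p)
  Converges-unique [] (_ ∷ _) (inj₁ _) p q = ⊥-elim (η-nothing≢η-just q)
  Converges-unique [] ks′ (inj₂ _) p q = ⊥-elim (η-nothing≢η-just p)
  Converges-unique (_ ∷ _) [] (inj₂ _) p q = ⊥-elim (η-nothing≢η-just q)
  Converges-unique (_ ∷ ks) (_ ∷ ks′) (inj₂ (n , e)) p q k =
    proj₁ (proj₂ (χ n)) λ (b , β) →
      let c , φ≡ , p′ = Converges-∷⁻ β p
          c′ , φ≡′ , q′ = Converges-∷⁻ β q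
      in Converges-unique ks ks′ ⟦ c ⟧ p′
           (subst (λ c → Converges ks′ ⟦ c ⟧ _) (sym (φ-deterministic φ≡ φ≡′)) q′)
           λ (l , m) → k (cong suc l , m)

  ◯-Defined-stable : MarkovInduction C → ∀ x → Stable (◯ (Defined x))
  ◯-Defined-stable mi x nn = Markov-pred mi P step ν x λ _ → ⌜⌝-elim
    where
    DefinedIn : ℕ ⊎ (ℕ × ℕ) → ℕ → Set
    DefinedIn x m = Σ[ ks ∈ List ℕ ] Σ[ n ∈ ℕ ] length ks ≡ m × Converges ks x n

    P : ∇₀ ℕ → Set
    P ν = ∀ x → (∀ m → ν ↓= m → ¬ ¬ DefinedIn x m) → ◯ (Defined x)

    step : ∀ ν → ((ν≢0 : ¬ (ν ↓= 0)) → P (pred ν ν≢0)) → P ν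
    step ν ih (inj₁ n) h = η ([] , n , refl)
    step ν ih (inj₂ (n , e)) h = ◯-bind (point n) λ (b , β) →
      let k , c , φ≡ = Markov's-principle mi (λ k → φ e k b) (φ-functional e b) (halts β)
      in ◯-map (λ (ks , m , p) → k ∷ ks , m , Converges-∷ β φ≡ p)
           (ih ν≢0 ⟦ c ⟧ λ m p k → h (suc m) p λ
             { ([] , _ , _ , q) → η-nothing≢η-just q
             ; (k′ ∷ ks , l , refl , q) →
                 let c′ , φ≡′ , q′ = Converges-∷⁻ β q
                 in k (ks , l , refl ,
                       subst (λ c → Converges ks ⟦ c ⟧ l) (φ-deterministic φ≡′ φ≡) q′) })
      where
      ν≢0 : ¬ (ν ↓= 0)
      ν≢0 p = h 0 p λ
        { ([] , _ , _ , q) → η-nothing≢η-just q ; (_ ∷ _ , _ , () , _) }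

      halts : ∀ {b} → χ n ↓= b → ¬ ¬ (∃[ k ] ∃[ c ] φ e k b ≡ just c)
      halts β j = proj₁ (proj₂ ν) λ (m , p) → h m p λ
        { ([] , _ , _ , q) → η-nothing≢η-just q
        ; (k ∷ _ , _ , _ , q) → let c , φ≡ , _ = Converges-∷⁻ β q in j (k , c , φ≡) }

    ν : ∇₀ ℕ
    ν = (λ m → ⌜ DefinedIn x m ⌝) ,
        (λ k → nn λ d → ◯⇒¬¬ d λ (ks , n , p) →
          k (length ks , ⌜⌝-intro λ j → j (ks , n , refl , p))) ,
        λ m m′ d d′ k → ⌜⌝-elim d λ { (ks , _ , refl , p) →
          ⌜⌝-elim d′ λ { (ks′ , _ , refl , p′) →
            Converges-unique ks ks′ x p p′ (k ∘ proj₁) } }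

  ψ-value-η : ∀ e D → ψ-value e (η D) ≡ η (proj₁ (proj₂ D))
  ψ-value-η e D = ◯-bind-η D _

  ψ-value-unique : ∀ e (d d′ : ψ e ↓) → ψ-value e d ≡ ψ-value e d′
  ψ-value-unique e d d′ = ◯-≡-stable (λ x y → decidable-stable (x ≟ y)) _ _ λ k →
    η-dense d λ { (D@(ks , _ , p) , refl) → η-dense d′ λ { (D′@(ks′ , _ , p′) , refl) →
      Converges-unique ks ks′ ⟦ e ⟧ p p′ λ (_ , n≡n′) →
        k (trans (ψ-value-η e D) (trans (cong η n≡n′) (sym (ψ-value-η e D′)))) } }

  ψ↓=-stable : MarkovInduction C → ∀ e z → Stable (ψ e ↓= z)
  ψ↓=-stable mi e z nn = d ,
    ◯-≡-stable (λ x y → decidable-stable (x ≟ y)) _ _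
      λ k → nn λ (d′ , q) → k (trans (ψ-value-unique e d d′) q)
    where
    d : ψ e ↓
    d = ◯-Defined-stable mi ⟦ e ⟧ λ k → nn (k ∘ proj₁)

  ψ↓=-intro : ∀ {e x ks n} → ⟦ e ⟧ ≡ x → Converges ks x n → ψ e ↓= η n
  ψ↓=-intro {e} {ks = ks} {n} refl p = η (ks , n , p) , ψ-value-η e _

  ψ-inj₁ : ∀ n → ψ Inverse.from θ (inj₁ n) ↓= η n
  ψ-inj₁ n = ψ↓=-intro {ks = []} (Inverse.strictlyInverseˡ θ (inj₁ n)) refl

  ψ-inj₂ : MarkovInduction C → ∀ {n e b c z} → χ n ↓= b → φ⟨ e ⟩ b ↓= c →
           ψ c ↓= z → ψ Inverse.from θ (inj₂ (n , e)) ↓= z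
  ψ-inj₂ mi {n} {e} {b} {c} β (k , φ≡) (d , refl) = ψ↓=-stable mi _ _ λ j →
    η-dense d λ { (D@(ks , m , p) , refl) →
      j (subst (ψ _ ↓=_) (sym (ψ-value-η c D))
          (ψ↓=-intro {ks = k ∷ ks} (Inverse.strictlyInverseˡ θ (inj₂ (n , e)))
            (Converges-∷ β φ≡ p))) }

  module _ (T : PropositionalTruncation) (mi : MarkovInduction C)
           (cc : ComputableChoice T C K) where
    open PropositionalTruncation T hiding (∥_∥)

    HasCode : ◯ ℕ → Set
    HasCode z = ∥_∥ T (∃[ e ] ψ e ↓= z)

    HasCode-local : ∀ z n → (_↓ C (χ n) → HasCode z) → HasCode z
    HasCode-local z n h = ∥∥-rec ∥∥-prop
      (λ (e , e-spec) → ∣ Inverse.from θ (inj₂ (n , e)) ,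
        ψ↓=-stable mi _ z (λ k → proj₁ (proj₂ (χ n)) λ (b , β) →
          ∥∥-rec (λ ()) (λ (c , p) →
            let (_ , halts) , r = e-spec b λ j → j (c , ⌜⌝-intro λ i → i (β , p))
            in ⌜⌝-elim r λ (_ , q) → k (ψ-inj₂ mi β halts q))
          (h (b , β))) ∣)
      (cc (λ b c → ⌜ R b c ⌝) λ b nn →
        let β = El-stable _ λ k → nn λ (_ , r) → ⌜⌝-elim r (k ∘ proj₁)
        in ∥∥-rec ∥∥-prop (λ (c , p) → ∣ c , ⌜⌝-intro (λ i → i (β , p)) ∣) (h (b , β)))
      where
      R : ℕ → ℕ → Set
      R b c = χ n ↓= b × ψ c ↓= z

    hasCode : ∀ z → HasCode z
    hasCode z = proj₁ (proj₁ HasCode-isModal)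
      (◯-ind HasCode (λ n → η ∣ Inverse.from θ (inj₁ n) , ψ-inj₁ n ∣) z)
      where
      HasCode-isModal : isModal (HasCode z)
      HasCode-isModal = isNull⇒isModal (isNull-irrelevant ∥∥-prop (HasCode-local z))

open Nullification using (◯)
open Coding using (ψ_↓=_)

mainTheorem16 : FunExt → Univalence →
    (T : PropositionalTruncation) (C : ¬¬-Classifier) (K : Computation) →
    MarkovInduction C → ComputableChoice T C K →
    (θ : ℕ ↔ (ℕ ⊎ (ℕ × ℕ))) (χ : Oracle C ℕ ℕ)
    (N : Nullification (λ n → _↓ C (χ n))) (z : ◯ N ℕ) →
    ∥_∥ T (∃[ e ] (ψ_↓=_ C K θ χ N e z))
mainTheorem16 ext ua T C K mi cc θ χ N z =
  CodingProperties.hasCode ext ua C K θ χ N T mi cc z
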